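{- Let $\mathcal{H}=(V,E)$ be a natural hb-graph with no repeated hb-edge and no empty hb-edge, with $V=\{v_1,\dots,v_n\}$ and $E=(e_i)_{i\in\{1,\dots,p\}}$, $p\ge1$. Let $\mathcal{A}=(a_{i_1\ldots i_{r_{\mathcal{H}}}})$ be any one of the three $e$-adjacency tensors of $\mathcal{H}$ (straightforward, silo or layered), of dimension $n+n_{\mathcal{A}}$. Then for every $j\in\{1,\dots,n\}$, $$\sum_{j_2,\dots,j_{r_{\mathcal{H}}}\in\{1,\dots,n+n_{\mathcal{A}}\}}a_{j j_2\ldots j_{r_{\mathcal{H}}}}=\sum_{i\,:\,v_j\in e_i}m_{i\,j}=\deg_m(v_j).$$
   Context: A natural multiset with universe $V$ is given by a multiplicity function $V\to\mathbb{N}$; its support is the set of elements of nonzero multiplicity and its m-cardinality $\#_m$ is the sum of its multiplicities. A natural hb-graph $\mathcal{H}=(V,E)$ consists of a nonempty finite set $V$ and a finite family $E=(e_i)$ of natural multisets with universe $V$ (hb-edges); no repeated hb-edge means the $e_i$ are pairwise distinct. Write $m_{i\,j}$ for the multiplicity of $v_j$ in $e_i$, and $v_j\in e_i$ when $m_{i\,j}\ne0$. The m-degree of $v_j$ is $\deg_m(v_j)=\#_m\{e^{m_e(v_j)}:e\in E,\ m_e(v_j)\neq 0\}$, the sum over hb-edges of the multiplicities of $v_j$. Put $r_{\mathcal{H}}=\max_{e\in E}\#_m e$. All three tensors are symmetric hypermatrices of order $r_{\mathcal{H}}$, of dimension $n+n_{\mathcal{A}}$, of the form $\mathcal{A}=\sum_{i=1}^{p}T_i$,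 where $T_i$ is the contribution of $e_i=\{v_{j_1}^{m_{ij_1}},\ldots,v_{j_{k_i}}^{m_{ij_{k_i}}}\}$ (support $\{v_{j_1},\dots,v_{j_{k_i}}\}$). The nonzero entries of $T_i$ are exactly those whose index tuple is a permutation of a multiset $M_i$ of $r_{\mathcal{H}}$ indices, all having the same value $t_i$: - Straightforward: $n_{\mathcal{A}}=1$, $M_i=\{j_1^{m_{ij_1}},\ldots,j_{k_i}^{m_{ij_{k_i}}},(n+1)^{r_{\mathcal{H}}-\#_m e_i}\}$, $t_i=\dfrac{m_{ij_1}!\cdots m_{ij_{k_i}}!\,(r_{\mathcal{H}}-\#_m e_i)!}{(r_{\mathcal{H}}-1)!}$. - Silo: $n_{\mathcal{A}}=r_{\mathcal{H}}-1$, $M_i=\{j_1^{m_{ij_1}},\ldots,j_{k_i}^{m_{ij_{k_i}}},(n+\#_m e_i)^{r_{\mathcal{H}}-\#_m e_i}\}$ (no added index if $\#_m e_i=r_{\mathcal{H}}$), $t_i=\dfrac{m_{ij_1}!\cdots m_{ij_{k_i}}!\,(r_{\mathcal{H}}-\#_m e_i)!}{(r_{\mathcal{H}}-1)!}$. - Layered: $n_{\mathcal{A}}=r_{\mathcal{H}}-1$, $M_i=\{j_1^{m_{ij_1}},\ldots,j_{k_i}^{m_{ij_{k_i}}},(n+\#_m e_i)^{1},(n+\#_m e_i+1)^1,\ldots,(n+r_{\mathcal{H}}-1)^{1}\}$ (no added index if $\#_m e_i=r_{\mathcal{H}}$), $t_i=\dfrac{m_{ij_1}!\cdots m_{ij_{k_i}}!}{(r_{\mathcal{H}}-1)!}$.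 -}

module Defs where

import Algebra.Properties.CommutativeMonoid.Sum as Sum
open import Data.Bool.Base using (if_then_else_)
open import Data.Fin.Base using (Fin; zero; suc; toℕ)
open import Data.Fin.Properties as Fin using (all?)
open import Data.Integer.Base using (+_)
open import Data.List.Base using (List; allFin; filter; map; tabulate)
open import Data.List.Extrema.Nat using (max; xs≤max)
open import Data.List.Relation.Unary.All.Properties using (tabulate⁻)
open import Data.Nat.Base as ℕ
  using (ℕ; zero; suc; _+_; _∸_; _*_; _!; _≤_; NonZero)
open import Data.Nat.ListAction using (sum; product)
open import Data.Nat.Properties as ℕ using (_≟_; _≤?_; _!≢0)
open import Data.Rational.Base as ℚ using (ℚ; 0ℚ; _/_)
import Data.Rational.Properties as ℚ
open import Data.Vec.Base using (Vec; []; _∷_; count)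
open import Data.Vec.Functional using (Vector; _++_; replicate)
open import Function.Base using (_∘_)
open import Relation.Binary.PropositionalEquality
  using (_≡_; _≢_; _≗_; subst)
open import Relation.Nullary using (Dec; does; ¬_; ¬?)

module Sumℕ = Sum ℕ.+-0-commutativeMonoid
module Sumℚ = Sum ℚ.+-0-commutativeMonoid

-- Multisets with universe Fin n, given by their multiplicity function.

Multiset : ℕ → Set
Multiset n = Vector ℕ n

infix 4 _∈ₘ_ _∈ₘ?_

_∈ₘ_ : ∀ {n} → Fin n → Multiset n → Set
j ∈ₘ e = e j ≢ 0

_∈ₘ?_ : ∀ {n} (j : Fin n) (e : Multiset n) → Dec (j ∈ₘ e)
j ∈ₘ? e = ¬? (e j ≟ 0)

Empty : ∀ {n} → Multiset n → Set
Empty e = ∀ j → ¬ (j ∈ₘ e)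

support : ∀ {n} → Multiset n → List (Fin n)
support e = filter (_∈ₘ? e) (allFin _)

#ₘ : ∀ {n} → Multiset n → ℕ
#ₘ e = Sumℕ.sum e

-- The vertices v₁, …, vₙ are the elements of Fin n; edge i j is the
-- multiplicity of the vertex j in the hb-edge i.

record HbGraph (n p : ℕ) : Set where
  field
    nonempty : NonZero n
    edge     : Fin p → Multiset n

open HbGraph public

NoRepeatedEdge : ∀ {n p} → HbGraph n p → Set
NoRepeatedEdge H = ∀ {i k} → i ≢ k → ¬ (edge H i ≗ edge H k)

NoEmptyEdge : ∀ {n p} → HbGraph n p → Set
NoEmptyEdge H = ∀ i → ¬ Empty (edge H i)

-- The m-cardinality of the multiset, with universe the hb-edges, in
-- which each hb-edge has as multiplicity the multiplicity of j in it.

degₘ : ∀ {n p} → HbGraph n p → Fin n → ℕ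
degₘ {p = p} H j = #ₘ star
  where
  star : Multiset p
  star i = edge H i j

incidentSum : ∀ {n p} → HbGraph n p → Fin n → ℕ
incidentSum {p = p} H j =
  sum (map (λ i → edge H i j) (filter (λ i → j ∈ₘ? edge H i) (allFin p)))

-- r_H; the default value 0 only matters when there is no hb-edge.

rank : ∀ {n p} → HbGraph n p → ℕ
rank H = max 0 (tabulate (#ₘ ∘ edge H))

Tensor : (order dim : ℕ) → Set
Tensor r N = Vec (Fin N) r → ℚ

sumTuples : ∀ {N} k → (Vec (Fin N) k → ℚ) → ℚ
sumTuples         zero    f = f []
sumTuples {N = N} (suc k) f =
  Sumℚ.sum {N} (λ x → sumTuples k (λ xs → f (x ∷ xs)))

-- ∑_{j₂,…,jᵣ} a_{j j₂ … jᵣ}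

rowSum : ∀ {r N} .{{_ : NonZero r}} → Tensor r N → Fin N → ℚ
rowSum {r = suc k} a j = sumTuples k (λ js → a (j ∷ js))

IsPermutationOf : ∀ {N r} → Multiset N → Vec (Fin N) r → Set
IsPermutationOf M js = ∀ x → count (x Fin.≟_) js ≡ M x

isPermutationOf? : ∀ {N r} (M : Multiset N) (js : Vec (Fin N) r) →
                   Dec (IsPermutationOf M js)
isPermutationOf? M js = all? (λ x → count (x Fin.≟_) js ≟ M x)

data Kind : Set where
  straightforward silo layered : Kind

addedDim : Kind → ℕ → ℕ
addedDim straightforward r = 1
addedDim silo            r = r ∸ 1
addedDim layered         r = r ∸ 1

-- The multiset M_i. Fin is 0-based, so the added position l stands for
-- the 1-based index n + suc (toℕ l). When #ₘ e ≡ r there is no added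
-- position with suc (toℕ l) ≥ r, so no index is added.

indexMultiset : ∀ {n} k r → Multiset n → Multiset (n + addedDim k r)
indexMultiset straightforward r e = e ++ replicate 1 (r ∸ #ₘ e)
indexMultiset silo            r e =
  e ++ λ l → if does (suc (toℕ l) ≟ #ₘ e) then r ∸ #ₘ e else 0
indexMultiset layered         r e =
  e ++ λ l → if does (#ₘ e ≤? suc (toℕ l)) then 1 else 0

multFactorials : ∀ {n} → Multiset n → ℕ
multFactorials e = product (map (λ j → e j !) (support e))

numerator : ∀ {n} → Kind → ℕ → Multiset n → ℕ
numerator straightforward r e = multFactorials e * (r ∸ #ₘ e) !
numerator silo            r e = multFactorials e * (r ∸ #ₘ e) !
numerator layered         r e = multFactorials e

entry : ∀ {n} → Kind → ℕ → Multiset n → ℚ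
entry k r e = (+ numerator k r e / (r ∸ 1) !) {{ (r ∸ 1) !≢0 }}

contribution : ∀ {n} k r → Multiset n → Tensor r (n + addedDim k r)
contribution k r e js =
  if does (isPermutationOf? (indexMultiset k r e) js) then entry k r e else 0ℚ

adjacencyTensor : ∀ {n p} k (H : HbGraph n p) →
                  Tensor (rank H) (n + addedDim k (rank H))
adjacencyTensor {p = p} k H js =
  Sumℚ.sum {p} (λ i → contribution k (rank H) (edge H i) js)

private
  #ₘ≡0⇒Empty : ∀ {n} (e : Multiset n) → #ₘ e ≡ 0 → Empty e
  #ₘ≡0⇒Empty e eq zero    e₀≢0 = e₀≢0 (ℕ.m+n≡0⇒m≡0 (e zero) eq)
  #ₘ≡0⇒Empty e eq (suc j) eⱼ≢0 =
    #ₘ≡0⇒Empty (e ∘ suc) (ℕ.m+n≡0⇒n≡0 (e zero) eq) j eⱼ≢0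

rank≢0 : ∀ {n p} .{{_ : NonZero p}} (H : HbGraph n p) →
         NoEmptyEdge H → NonZero (rank H)
rank≢0 {p = suc _} H noEmpty = ℕ.≢-nonZero λ rank≡0 →
  noEmpty zero (#ₘ≡0⇒Empty (edge H zero)
    (ℕ.n≤0⇒n≡0 (subst (#ₘ (edge H zero) ≤_) rank≡0
      (tabulate⁻ {f = #ₘ ∘ edge H}
        (xs≤max 0 (tabulate (#ₘ ∘ edge H))) zero))))

{-# OPTIONS --safe #-}

-- Call a tuple an arrangement of a multiset M of m-cardinality k if it is a
-- permutation of M. By induction on k, M has k! / ∏ₓ (M x)! arrangements:
-- those starting with x correspond to the arrangements of M with one copy of
-- x deleted, so, after clearing the denominator, there are M x · (k - 1)! of
-- them, and ∑ₓ M x = k. For the multiset Mᵢ of r indices attached to eᵢ, the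
-- entry tᵢ is ∏ₓ (Mᵢ x)! / (r - 1)!, hence the arrangements of Mᵢ starting
-- with j contribute exactly Mᵢ j = m_{i j} to the row sum.

module Submission where

open import Defs
open import Algebra.Bundles using (CommutativeMonoid)
import Algebra.Properties.CommutativeMonoid.Sum as Sum
import Algebra.Properties.CommutativeSemigroup as CommutativeSemigroup
import Algebra.Properties.Monoid.Mult as Mult
open import Data.Bool.Base using (true; false; if_then_else_)
open import Data.Bool.Properties using (if-cong; if-cong-then)
open import Data.Fin.Base using (Fin; zero; suc; toℕ; _↑ˡ_; splitAt)
import Data.Fin.Properties as Fin
open import Data.Integer.Base as ℤ using (+_)
import Data.Integer.Properties as ℤ
open import Data.List.Base as List using (filter; tabulate)
open import Data.List.Extrema.Nat using (xs≤max)
open import Data.List.Relation.Unary.All.Properties using (tabulate⁻)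
open import Data.Nat.Base using (ℕ; zero; suc; pred; _+_; _*_; _∸_; _!; _≤_; s≤s; NonZero)
open import Data.Nat.Properties as ℕ using (_≟_; _≤?_; _!≢0)
open import Data.Product.Base using (_×_; _,_)
open import Data.Rational.Base as ℚ using (ℚ; 0ℚ; 1ℚ; _/_)
import Data.Rational.Properties as ℚ
open import Data.Rational.Unnormalised.Base using (mkℚᵘ; *≡*)
import Data.Rational.Unnormalised.Properties as ℚᵘ
open import Data.Sum.Base using (inj₁; inj₂)
open import Data.Vec.Base using (Vec; []; _∷_)
open import Data.Vec.Functional using (Vector; _++_; updateAt)
open import Data.Vec.Functional.Properties
  using (lookup-++ˡ; updateAt-updates; updateAt-minimal)
open import Function.Base using (_∘_; id)
open import Function.Bundles using (_⇔_; mk⇔)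
open import Relation.Binary.PropositionalEquality
  using (_≡_; _≢_; refl; sym; trans; cong; cong₂; module ≡-Reasoning)
open import Relation.Nullary using (¬_; does; yes; no; contradiction)
open import Relation.Nullary.Decidable using (dec-true; dec-false; does-⇔; decidable-stable)
open import Relation.Unary using (Pred; Decidable)

-- Sums in a commutative monoid

module SumProperties {c ℓ} (M : CommutativeMonoid c ℓ) where
  open CommutativeMonoid M
    using (Carrier; _≈_; _∙_; ε; ∙-congˡ; ∙-congʳ; identityˡ; identityʳ; assoc;
           commutativeSemigroup)
    renaming (refl to ≈-refl; sym to ≈-sym; trans to ≈-trans)
  open Sum M using (sum; sum-cong-≋; sum-replicate-zero)
  open CommutativeSemigroup commutativeSemigroup using (x∙yz≈y∙xz)

  -- The map `g` lets one proof serve both monoids: `id` over addition for `#ₘ`, `_!` over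
  -- multiplication for `factorials`.
  sum-++ : ∀ {a} {A : Set a} (g : A → Carrier) {m n}
           (xs : Vector A m) (ys : Vector A n) →
           sum (g ∘ (xs ++ ys)) ≈ sum (g ∘ xs) ∙ sum (g ∘ ys)
  sum-++ g {zero}  xs ys = ≈-sym (identityˡ _)
  sum-++ g {suc m} xs ys = ≈-trans
    (∙-congˡ (≈-trans (sum-cong-≋ tail-++) (sum-++ g (xs ∘ suc) ys)))
    (≈-sym (assoc _ _ _))
    where
    tail-++ : ∀ i → g ((xs ++ ys) (suc i)) ≈ g (((xs ∘ suc) ++ ys) i)
    tail-++ i with splitAt m i
    ... | inj₁ _ = ≈-refl
    ... | inj₂ _ = ≈-refl

  -- Only the term at `i` changes. A monoid has no subtraction, so the lost amount `y` is given by
  -- an equation.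
  sum-updateAt : ∀ {a} {A : Set a} (g : A → Carrier) {n}
                 (t : Vector A n) i {f : A → A} {y} →
                 g (t i) ≈ y ∙ g (f (t i)) →
                 sum (g ∘ t) ≈ y ∙ sum (g ∘ updateAt t i f)
  sum-updateAt g {suc n} t zero    eq =
    ≈-trans (∙-congʳ eq) (assoc _ _ _)
  sum-updateAt g {suc n} t (suc i) eq =
    ≈-trans (∙-congˡ (sum-updateAt g (t ∘ suc) i eq)) (x∙yz≈y∙xz _ _ _)

  -- When s ≡ n no position is selected, and the sum is g 0.
  sum-select : ∀ (g : ℕ → Carrier) → g 0 ≈ ε → ∀ {n s} x → s ≤ n →
               (s ≡ n → x ≡ 0) →
               sum {n} (λ l → g (if does (suc (toℕ l) ≟ suc s) then x else 0)) ≈ g x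
  sum-select g g0 {zero}  {zero}  x s≤n x≡0 rewrite x≡0 refl = ≈-sym g0
  sum-select g g0 {suc n} {zero}  x s≤n x≡0 =
    ≈-trans (∙-congˡ (≈-trans (sum-cong-≋ {n} (λ _ → g0)) (sum-replicate-zero n))) (identityʳ _)
  sum-select g g0 {suc n} {suc s} x (s≤s s≤n) x≡0 =
    ≈-trans (∙-congˡ (sum-select g g0 x s≤n (x≡0 ∘ cong suc)))
      (≈-trans (∙-congʳ g0) (identityˡ _))

  -- The discarded terms are neutral: 0 in a sum of multiplicities, 0! = 1 in a product of
  -- factorials.
  foldr-filter-tabulate :
    ∀ {a p} {A : Set a} {P : Pred A p} (P? : Decidable P) (f : A → Carrier) →
    (∀ {x} → ¬ P x → f x ≈ ε) → ∀ {n} (g : Fin n → A) →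
    List.foldr _∙_ ε (List.map f (filter P? (tabulate g))) ≈ sum (f ∘ g)
  foldr-filter-tabulate P? f f≈ε {zero}  g = ≈-refl
  foldr-filter-tabulate P? f f≈ε {suc n} g with P? (g zero)
  ... | yes _  = ∙-congˡ (foldr-filter-tabulate P? f f≈ε (g ∘ suc))
  ... | no ¬Pg = ≈-trans (foldr-filter-tabulate P? f f≈ε (g ∘ suc))
    (≈-sym (≈-trans (∙-congʳ (f≈ε ¬Pg)) (identityˡ _)))

module Prodℕ = Sum ℕ.*-1-commutativeMonoid
module Sumℕ⁺ = SumProperties ℕ.+-0-commutativeMonoid
module Prodℕ⁺ = SumProperties ℕ.*-1-commutativeMonoid

open Mult (CommutativeMonoid.monoid ℚ.+-0-commutativeMonoid)
  using (×-homo-+; ×-assocˡ) renaming (_×_ to infixr 8 _·_)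

open ≡-Reasoning

-- Natural multiples of rationals

·-comm : ∀ m n q → m · n · q ≡ n · m · q
·-comm m n q = begin
  m · n · q    ≡⟨ ×-assocˡ q m n ⟩
  (m * n) · q  ≡⟨ cong (_· q) (ℕ.*-comm m n) ⟩
  (n * m) · q  ≡⟨ ×-assocˡ q n m ⟨
  n · m · q    ∎

sum-· : ∀ {n} (f : Vector ℕ n) q → Sumℚ.sum (λ i → f i · q) ≡ Sumℕ.sum f · q
sum-· {zero}  f q = refl
sum-· {suc n} f q =
  trans (cong (f zero · q ℚ.+_) (sum-· (f ∘ suc) q)) (sym (×-homo-+ q (f zero) _))

-- Passing to unnormalised fractions avoids gcds: equality there is cross-multiplication of
-- integers.
1/d+n/d≡[1+n]/d : ∀ n d .{{_ : NonZero d}} → + 1 / d ℚ.+ + n / d ≡ + suc n / d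
1/d+n/d≡[1+n]/d n (suc d) = ℚ.toℚᵘ-injective
  (ℚᵘ.≃-trans (ℚ.toℚᵘ-homo-+ (+ 1 / suc d) (+ n / suc d))
  (ℚᵘ.≃-trans (ℚᵘ.+-cong (ℚ.toℚᵘ-fromℚᵘ (mkℚᵘ (+ 1) d)) (ℚ.toℚᵘ-fromℚᵘ (mkℚᵘ (+ n) d)))
  (ℚᵘ.≃-trans (*≡* same) (ℚᵘ.≃-sym (ℚ.toℚᵘ-fromℚᵘ (mkℚᵘ (+ suc n) d))))))
  where
  D = + suc d
  same : (+ 1 ℤ.* D ℤ.+ + n ℤ.* D) ℤ.* D ≡ + suc n ℤ.* (D ℤ.* D)
  same = trans (cong (ℤ._* D) (sym (ℤ.*-distribʳ-+ D (+ 1) (+ n))))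
               (ℤ.*-assoc (+ suc n) D D)

n·1/d≡n/d : ∀ n d .{{_ : NonZero d}} → n · (+ 1 / d) ≡ + n / d
n·1/d≡n/d zero    (suc d) = sym (ℚ.fromℚᵘ-cong {mkℚᵘ (+ 0) d} {mkℚᵘ (+ 0) 0} (*≡* refl))
n·1/d≡n/d (suc n) d       =
  trans (cong (+ 1 / d ℚ.+_) (n·1/d≡n/d n d)) (1/d+n/d≡[1+n]/d n d)

n/n≡1 : ∀ n .{{_ : NonZero n}} → + n / n ≡ 1ℚ
n/n≡1 (suc n) =
  ℚ.fromℚᵘ-cong {mkℚᵘ (+ suc n) n} {mkℚᵘ (+ 1) 0} (*≡* (ℤ.*-comm (+ suc n) (+ 1)))

-- Sums over tuples

sumTuples-cong : ∀ {N} k {f g : Vec (Fin N) k → ℚ} → (∀ js → f js ≡ g js) →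
                 sumTuples k f ≡ sumTuples k g
sumTuples-cong zero    f≗g = f≗g []
sumTuples-cong (suc k) f≗g =
  Sumℚ.sum-cong-≗ (λ x → sumTuples-cong k (λ js → f≗g (x ∷ js)))

sumTuples-0 : ∀ {N} k → sumTuples {N} k (λ _ → 0ℚ) ≡ 0ℚ
sumTuples-0     zero    = refl
sumTuples-0 {N} (suc k) =
  trans (Sumℚ.sum-cong-≗ {N} (λ _ → sumTuples-0 k)) (Sumℚ.sum-replicate-zero N)

sumTuples-sum : ∀ {N p} k (f : Fin p → Vec (Fin N) k → ℚ) →
                sumTuples k (λ js → Sumℚ.sum (λ i → f i js)) ≡
                Sumℚ.sum (λ i → sumTuples k (f i))
sumTuples-sum zero    f = refl
sumTuples-sum (suc k) f =
  trans (Sumℚ.sum-cong-≗ (λ x → sumTuples-sum k (λ i js → f i (x ∷ js))))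
        (Sumℚ.∑-comm (λ x i → sumTuples k (λ js → f i (x ∷ js))))

rowSum-sum : ∀ {r N p} .{{_ : NonZero r}} (f : Fin p → Tensor r N) j →
             rowSum (λ js → Sumℚ.sum (λ i → f i js)) j ≡
             Sumℚ.sum (λ i → rowSum (f i) j)
rowSum-sum {suc k} f j = sumTuples-sum k (λ i js → f i (j ∷ js))

-- Arrangements of a multiset

-- `pred` fixes 0, so a copy is removed only where the multiplicity is positive, as the lemmas on
-- deletion assume.
delete : ∀ {N} → Fin N → Multiset N → Multiset N
delete x M = updateAt M x pred

-- Denominator of the multinomial coefficient; elements of multiplicity 0 contribute 0! = 1.
factorials : ∀ {N} → Multiset N → ℕ
factorials M = Prodℕ.sum (_! ∘ M)

#ₘ-delete : ∀ {N} (M : Multiset N) x {m} → M x ≡ suc m →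
            #ₘ M ≡ suc (#ₘ (delete x M))
#ₘ-delete M x Mx≡1+m = Sumℕ⁺.sum-updateAt id M x {y = 1} suc-pred
  where
  suc-pred : M x ≡ suc (pred (M x))
  suc-pred rewrite Mx≡1+m = refl

factorials-delete : ∀ {N} (M : Multiset N) x {m} → M x ≡ suc m →
                    factorials M ≡ M x * factorials (delete x M)
factorials-delete M x Mx≡1+m = Prodℕ⁺.sum-updateAt _! M x {y = M x} !-step
  where
  !-step : M x ! ≡ M x * (pred (M x)) !
  !-step rewrite Mx≡1+m = refl

∷-isPermutationOf : ∀ {N k} (M : Multiset N) {x m} (js : Vec (Fin N) k) →
                    M x ≡ suc m →
                    IsPermutationOf M (x ∷ js) ⇔ IsPermutationOf (delete x M) js
∷-isPermutationOf M {x} js Mx≡1+m = mk⇔ to from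
  where
  to : IsPermutationOf M (x ∷ js) → IsPermutationOf (delete x M) js
  -- `count` on `x ∷ js` branches on this comparison: the head counts exactly when `y` is `x`.
  to perm y with y Fin.≟ x | perm y
  ... | yes refl | eq = trans (cong pred eq) (sym (updateAt-updates x M))
  ... | no y≢x   | eq = trans eq (sym (updateAt-minimal y x M y≢x))

  from : IsPermutationOf (delete x M) js → IsPermutationOf M (x ∷ js)
  from perm y with y Fin.≟ x | perm y
  ... | yes refl | eq = trans
    (cong suc (trans eq (trans (updateAt-updates x M) (cong pred Mx≡1+m)))) (sym Mx≡1+m)
  ... | no y≢x   | eq = trans eq (updateAt-minimal y x M y≢x)

∷-¬isPermutationOf : ∀ {N k} (M : Multiset N) {x} (js : Vec (Fin N) k) →
                     M x ≡ 0 → ¬ IsPermutationOf M (x ∷ js)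
∷-¬isPermutationOf M {x} js Mx≡0 perm with x Fin.≟ x | trans (perm x) Mx≡0
... | yes _  | ()
... | no x≢x | _ = x≢x refl

#ₘ≡0⇒≡0 : ∀ {N} (M : Multiset N) → #ₘ M ≡ 0 → ∀ x → M x ≡ 0
#ₘ≡0⇒≡0 M eq zero    = ℕ.m+n≡0⇒m≡0 (M zero) eq
#ₘ≡0⇒≡0 M eq (suc x) = #ₘ≡0⇒≡0 (M ∘ suc) (ℕ.m+n≡0⇒n≡0 (M zero) eq) x

-- `contribution k r e` unfolds to this form; the induction by deletion needs it for an arbitrary
-- multiset.
onArrangements : ∀ {N r} → Multiset N → ℚ → Tensor r N
onArrangements M q js = if does (isPermutationOf? M js) then q else 0ℚ

-- The multinomial count without division: the common value is a multiple of `factorials M`. The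
-- free `q` absorbs the factor split off by each deletion.
sum-arrangements : ∀ {N} k (M : Multiset N) q → #ₘ M ≡ k →
                   sumTuples k (onArrangements M (factorials M · q)) ≡ (k !) · q

-- Deleting the fixed first entry leaves a shorter arrangement and a factor `M x`. Besides serving
-- the induction, this is the form that a row sum needs.
sum-arrangements-∷ : ∀ {N} k (M : Multiset N) q x → #ₘ M ≡ suc k →
                     sumTuples k (λ js → onArrangements M (factorials M · q) (x ∷ js)) ≡
                     M x · (k !) · q

sum-arrangements {N} zero M q #M≡0 = begin
  onArrangements M (factorials M · q) []
    ≡⟨ if-cong (dec-true (isPermutationOf? M []) (sym ∘ M≗0)) ⟩
  factorials M · q
    ≡⟨ cong (_· q) (Prodℕ.sum-cong-≗ {N} (λ x → cong _! (M≗0 x))) ⟩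
  Prodℕ.sum {N} (λ _ → 1) · q
    -- In the multiplicative monoid, the `zero` in this name is the neutral element 1.
    ≡⟨ cong (_· q) (Prodℕ.sum-replicate-zero N) ⟩
  1 · q ∎
  where
  M≗0 = #ₘ≡0⇒≡0 M #M≡0
sum-arrangements (suc k) M q #M≡1+k = begin
  Sumℚ.sum (λ x → sumTuples k (λ js → onArrangements M (factorials M · q) (x ∷ js)))
    ≡⟨ Sumℚ.sum-cong-≗ (λ x → sum-arrangements-∷ k M q x #M≡1+k) ⟩
  Sumℚ.sum (λ x → M x · (k !) · q)
    ≡⟨ sum-· M _ ⟩
  #ₘ M · (k !) · q
    ≡⟨ cong (_· (k !) · q) #M≡1+k ⟩
  suc k · (k !) · q
    ≡⟨ ×-assocˡ q (suc k) (k !) ⟩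
  (suc k !) · q ∎

sum-arrangements-∷ k M q x #M≡1+k with M x in Mx≡
... | zero  = begin
  sumTuples k (λ js → onArrangements M (factorials M · q) (x ∷ js))
    ≡⟨ sumTuples-cong k (λ js →
         if-cong (dec-false (isPermutationOf? M (x ∷ js)) (∷-¬isPermutationOf M js Mx≡))) ⟩
  sumTuples k (λ _ → 0ℚ)
    ≡⟨ sumTuples-0 k ⟩
  0ℚ ∎
... | suc m = begin
  sumTuples k (λ js → onArrangements M (factorials M · q) (x ∷ js))
    ≡⟨ sumTuples-cong k (λ js → trans
         (if-cong (does-⇔ (∷-isPermutationOf M js Mx≡)
           (isPermutationOf? M (x ∷ js)) (isPermutationOf? (delete x M) js)))
         (if-cong-then (does (isPermutationOf? (delete x M) js)) rescale)) ⟩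
  sumTuples k (onArrangements (delete x M) (factorials (delete x M) · suc m · q))
    ≡⟨ sum-arrangements k (delete x M) (suc m · q)
         (ℕ.suc-injective (trans (sym (#ₘ-delete M x Mx≡)) #M≡1+k)) ⟩
  (k !) · suc m · q
    ≡⟨ ·-comm (k !) (suc m) q ⟩
  suc m · (k !) · q ∎
  where
  rescale : factorials M · q ≡ factorials (delete x M) · suc m · q
  rescale = begin
    factorials M · q                        ≡⟨ cong (_· q) (factorials-delete M x Mx≡) ⟩
    -- The `with` replaced `M x` by `suc m` in the goal only, so it is rewritten here by hand.
    (M x * factorials (delete x M)) · q     ≡⟨ cong (λ y → (y * factorials (delete x M)) · q) Mx≡ ⟩
    (suc m * factorials (delete x M)) · q   ≡⟨ ×-assocˡ q (suc m) (factorials (delete x M)) ⟨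
    suc m · factorials (delete x M) · q     ≡⟨ ·-comm (suc m) (factorials (delete x M)) q ⟩
    factorials (delete x M) · suc m · q     ∎

-- The index multisets

-- With m-cardinality `suc s` and order `suc n`, the layers added are the positions from `s` on.
sum-≤? : ∀ n s → Sumℕ.sum {n} (λ l → if does (suc s ≤? suc (toℕ l)) then 1 else 0) ≡ n ∸ s
sum-≤? zero    zero    = refl
sum-≤? zero    (suc s) = refl
sum-≤? (suc n) zero    = cong suc (sum-≤? n zero)
sum-≤? (suc n) (suc s) = sum-≤? n s

-- The padding supplies the missing `r ∸ #ₘ e` indices. In the silo and layered forms the added
-- positions stand for the m-cardinalities 1 to r - 1, hence the assumption that `#ₘ e` is nonzero.
#ₘ-indexMultiset : ∀ {n} k r (e : Multiset n) → #ₘ e ≢ 0 → #ₘ e ≤ r →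
                   #ₘ (indexMultiset k r e) ≡ r
#ₘ-indexMultiset k r e #e≢0 #e≤r = begin
  #ₘ (indexMultiset k r e)      ≡⟨ split k ⟩
  #ₘ e + (r ∸ #ₘ e)             ≡⟨ ℕ.m+[n∸m]≡n #e≤r ⟩
  r                             ∎
  where
  added-silo : ∀ {r s} → s ≢ 0 → s ≤ r →
    Sumℕ.sum {r ∸ 1} (λ l → if does (suc (toℕ l) ≟ s) then r ∸ s else 0) ≡ r ∸ s
  added-silo {s = zero}          s≢0 _         = contradiction refl s≢0
  added-silo {suc r} {s = suc s} _   (s≤s s≤r) =
    -- A full hb-edge, `s ≡ r`, selects no position, but then nothing is to be added: r ∸ r = 0.
    Sumℕ⁺.sum-select id refl (r ∸ s) s≤r (λ { refl → ℕ.n∸n≡0 r })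

  added-layered : ∀ {r s} → s ≢ 0 → s ≤ r →
    Sumℕ.sum {r ∸ 1} (λ l → if does (s ≤? suc (toℕ l)) then 1 else 0) ≡ r ∸ s
  added-layered {s = zero}          s≢0 _         = contradiction refl s≢0
  added-layered {suc r} {s = suc s} _   _         = sum-≤? r s

  split : ∀ k → #ₘ (indexMultiset k r e) ≡ #ₘ e + (r ∸ #ₘ e)
  split straightforward =
    trans (Sumℕ⁺.sum-++ id e _) (cong (λ x → #ₘ e + x) (ℕ.+-identityʳ _))
  split silo    =
    trans (Sumℕ⁺.sum-++ id e _) (cong (λ x → #ₘ e + x) (added-silo #e≢0 #e≤r))
  split layered =
    trans (Sumℕ⁺.sum-++ id e _) (cong (λ x → #ₘ e + x) (added-layered #e≢0 #e≤r))

factorials≡multFactorials : ∀ {n} (e : Multiset n) → factorials e ≡ multFactorials e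
factorials≡multFactorials e = sym
  (Prodℕ⁺.foldr-filter-tabulate (_∈ₘ? e) (_! ∘ e)
    (λ {x} x∉e → cong _! (decidable-stable (e x ≟ 0) x∉e)) id)

-- The numerators are products of factorials over all of Mᵢ: an index repeated `r ∸ #ₘ e` times
-- gives `(r ∸ #ₘ e) !`, while distinct layers give 1! each.
factorials-indexMultiset : ∀ {n} k r (e : Multiset n) → #ₘ e ≢ 0 → #ₘ e ≤ r →
                           factorials (indexMultiset k r e) ≡ numerator k r e
factorials-indexMultiset straightforward r e _ _ =
  trans (Prodℕ⁺.sum-++ _! e _)
        (cong₂ _*_ (factorials≡multFactorials e) (ℕ.*-identityʳ _))
factorials-indexMultiset silo r e #e≢0 #e≤r =
  trans (Prodℕ⁺.sum-++ _! e _)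
        (cong₂ _*_ (factorials≡multFactorials e) (added #e≢0 #e≤r))
  where
  added : ∀ {r s} → s ≢ 0 → s ≤ r →
    Prodℕ.sum {r ∸ 1} (λ l → (if does (suc (toℕ l) ≟ s) then r ∸ s else 0) !) ≡ (r ∸ s) !
  added {s = zero}          s≢0 _         = contradiction refl s≢0
  added {suc r} {s = suc s} _   (s≤s s≤r) =
    Prodℕ⁺.sum-select _! refl (r ∸ s) s≤r (λ { refl → ℕ.n∸n≡0 r })
factorials-indexMultiset layered r e _ _ = begin
  factorials (indexMultiset layered r e)
    ≡⟨ Prodℕ⁺.sum-++ _! e _ ⟩
  factorials e * Prodℕ.sum {r ∸ 1} (λ l → (if does (#ₘ e ≤? suc (toℕ l)) then 1 else 0) !)
    ≡⟨ cong₂ _*_ (factorials≡multFactorials e)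
         (trans (Prodℕ.sum-cong-≗ {r ∸ 1} added≗1) (Prodℕ.sum-replicate-zero (r ∸ 1))) ⟩
  multFactorials e * 1
    ≡⟨ ℕ.*-identityʳ _ ⟩
  multFactorials e ∎
  where
  added≗1 : ∀ (l : Fin (r ∸ 1)) → (if does (#ₘ e ≤? suc (toℕ l)) then 1 else 0) ! ≡ 1
  -- Used or not, a layer contributes 1, since 0! = 1! = 1.
  added≗1 l with does (#ₘ e ≤? suc (toℕ l))
  ... | true  = refl
  ... | false = refl

indexMultiset-↑ˡ : ∀ {n} k r (e : Multiset n) j →
                   indexMultiset k r e (j ↑ˡ addedDim k r) ≡ e j
indexMultiset-↑ˡ straightforward r e = lookup-++ˡ e _
indexMultiset-↑ˡ silo            r e = lookup-++ˡ e _
indexMultiset-↑ˡ layered         r e = lookup-++ˡ e _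

-- Row sums

rowSum-contribution : ∀ {n} k r .{{_ : NonZero r}} (e : Multiset n) j →
                      #ₘ e ≢ 0 → #ₘ e ≤ r →
                      rowSum (contribution k r e) (j ↑ˡ addedDim k r) ≡ e j · 1ℚ
rowSum-contribution k r@(suc r-1) e j #e≢0 #e≤r = begin
  rowSum (onArrangements M (entry k r e)) x
    ≡⟨ cong (λ q → rowSum (onArrangements M q) x) entry≡ ⟩
  -- Taking q = 1/(r - 1)! puts the entry in the form that the count requires; the factor (r - 1)!
  -- of the count then cancels.
  rowSum (onArrangements M (factorials M · (+ 1 / d))) x
    ≡⟨ sum-arrangements-∷ r-1 M (+ 1 / d) x (#ₘ-indexMultiset k r e #e≢0 #e≤r) ⟩
  M x · d · (+ 1 / d)
    ≡⟨ cong₂ _·_ (indexMultiset-↑ˡ k r e j) (trans (n·1/d≡n/d d d) (n/n≡1 d)) ⟩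
  e j · 1ℚ ∎
  where
  M = indexMultiset k r e
  x = j ↑ˡ addedDim k r
  d = r-1 !
  instance
    d≢0 : NonZero d
    d≢0 = r-1 !≢0
  entry≡ : entry k r e ≡ factorials M · (+ 1 / d)
  entry≡ = trans (sym (n·1/d≡n/d (numerator k r e) d))
    (cong (_· (+ 1 / d)) (sym (factorials-indexMultiset k r e #e≢0 #e≤r)))

-- An hb-edge missing `j` gives it multiplicity 0, so restricting to incident hb-edges loses
-- nothing.
incidentSum≡degₘ : ∀ {n p} (H : HbGraph n p) j → incidentSum H j ≡ degₘ H j
incidentSum≡degₘ H j =
  Sumℕ⁺.foldr-filter-tabulate (λ i → j ∈ₘ? edge H i) (λ i → edge H i j)
    (λ {i} → decidable-stable (edge H i j ≟ 0)) id

#ₘ-edge≤rank : ∀ {n p} (H : HbGraph n p) i → #ₘ (edge H i) ≤ rank H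
#ₘ-edge≤rank H = tabulate⁻ {f = #ₘ ∘ edge H} (xs≤max 0 (tabulate (#ₘ ∘ edge H)))

claim5p1 : ∀ {n p : ℕ} .{{_ : NonZero p}} (H : HbGraph n p) →
    NoRepeatedEdge H → (noEmpty : NoEmptyEdge H) →
    (k : Kind) (j : Fin n) →
    (rowSum {{rank≢0 H noEmpty}} (adjacencyTensor k H)
    (j ↑ˡ addedDim k (rank H))
    ≡ + incidentSum H j / 1)
    × (incidentSum H j ≡ degₘ H j)
claim5p1 {n} {p} H _ noEmpty k j = rowSum≡ , incidentSum≡degₘ H j
  where
  r = rank H
  x = j ↑ˡ addedDim k r
  instance
    r≢0 : NonZero r
    r≢0 = rank≢0 H noEmpty
  #e≢0 : ∀ i → #ₘ (edge H i) ≢ 0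
  #e≢0 i #e≡0 = noEmpty i (λ y y∈e → y∈e (#ₘ≡0⇒≡0 (edge H i) #e≡0 y))
  rowSum≡ : rowSum (adjacencyTensor k H) x ≡ + incidentSum H j / 1
  rowSum≡ = begin
    rowSum (adjacencyTensor k H) x
      ≡⟨ rowSum-sum (λ i → contribution k r (edge H i)) x ⟩
    Sumℚ.sum (λ i → rowSum (contribution k r (edge H i)) x)
      ≡⟨ Sumℚ.sum-cong-≗ (λ i → rowSum-contribution k r (edge H i) j (#e≢0 i) (#ₘ-edge≤rank H i)) ⟩
    Sumℚ.sum (λ i → edge H i j · 1ℚ)
      ≡⟨ sum-· (λ i → edge H i j) 1ℚ ⟩
    degₘ H j · 1ℚ
      -- `1ℚ` is `+ 1 / 1` by computation, so this is the case of denominator 1.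
      ≡⟨ n·1/d≡n/d (degₘ H j) 1 ⟩
    + degₘ H j / 1
      ≡⟨ cong (λ m → + m / 1) (incidentSum≡degₘ H j) ⟨
    + incidentSum H j / 1 ∎
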